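{- For any real $\alpha$ with $0<\alpha<4$, no strictly monotone deterministic online algorithm for maximizing a non-negative monotone submodular function under a partition matroid constraint with free disposal, on instances of the form described in the context (all parts of capacity $1$), can have competitive ratio strictly larger than $\frac1\alpha$.
   Context: Instances: let $\mathcal{U}$ be a universe of items with weights $\nu:\mathcal{U}\to\mathbb{R}_+$, and $\nu(X):=\sum_{x\in X}\nu(x)$ for $X\subseteq\mathcal{U}$. For $i\ge0$ let $\Omega_i:=\{(u,i):u\in\mathcal{U}\}$ and let $\Omega:=\bigcup_{i\ge0}\Omega_i$. A (finite) set $S\subset\Omega$ is independent iff $|S\cap\Omega_i|\le1$ for all $i$ (a partition matroid with unit capacities). The objective is $f(S):=\nu(\{x:(x,i)\in S\text{ for some }i\})$, which is monotone submodular. Online problem with free disposal: distinct elements of $\Omega$ arrive one by one in a finite sequence whose length is unknown to the algorithm. The algorithm maintains an independent set $S$, initially empty. When $u$ arrives, it may remove elements from $S$ and may include $u$ in $S$, as long as $S$ remains independent; rejected or removed elements cannot be retrieved. The algorithm has a value oracle for $f$ and an independence oracle, only on sets of elements that have arrived so far, so the decisions of a deterministic algorithm are determined by this information. $\mathsf{OPT}$ is an independent set of elements of the sequence maximizing $f$. A deterministic algorithm has competitive ratio $r$ if for every instance and at the end of every finite sequence, $f(S)\ge r\cdot f(\mathsf{OPT})$. Strict monotonicity: an algorithm is strictly monotone if, in each round, it includes the new arriving element into $S$ (possibly removing some elements from $S$) only if the objective value $f(S)$ strictly increases compared to its value at the beginning of the round. -}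

module Defs where

open import Data.Bool.Base using (Bool)
open import Data.Fin.Subset using (Subset; Side; inside; outside; _∩_)
open import Data.Integer.Base using (+_)
open import Data.List.Base using (List; []; _∷_; map; filter; length; foldr; deduplicate)
open import Data.List.Properties using (filter-none)
import Data.List.Relation.Unary.All as All
open import Data.List.Relation.Unary.All.Properties using (¬Any⇒All¬)
open import Data.List.Relation.Unary.Any using (any?)
open import Data.Nat.Base as ℕ using (ℕ; suc)
import Data.Nat.Properties as ℕ
open import Data.Product.Base using (∃-syntax; _×_; _,_; proj₁; proj₂)
open import Data.Rational.Base as ℚ using (ℚ; 0ℚ; 1ℚ; ∣_∣)
import Data.Rational.Properties as ℚ
open import Data.Rational.Solver using (module +-*-Solver)
open import Data.Vec.Base as Vec using (Vec; []; _∷_)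
open import Data.Vec.Relation.Unary.Unique.Propositional using (Unique)
open import Relation.Binary.Definitions using (DecidableEquality)
open import Relation.Binary.PropositionalEquality
open import Relation.Nullary using (Dec; yes; no; does)
open import Relation.Nullary.Decidable using (map′)

------------------------------------------------------------------------
-- Real numbers, as Cauchy sequences of rationals

CauchySeq : (ℕ → ℚ) → Set
CauchySeq x = ∀ ε → 0ℚ ℚ.< ε →
  ∃[ N ] (∀ m n → N ℕ.≤ m → N ℕ.≤ n → ∣ x m ℚ.- x n ∣ ℚ.≤ ε)

record ℝ : Set where
  constructor mkℝ
  field
    seq      : ℕ → ℚ
    isCauchy : CauchySeq seq

open ℝ public

infix  4 _<ℝ_ _≤ℝ_
infixl 6 _+ℝ_
infixl 7 _*ℝ_

_<ℝ_ : ℝ → ℝ → Set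
x <ℝ y = ∃[ ε ] 0ℚ ℚ.< ε × ∃[ N ] (∀ n → N ℕ.≤ n → seq x n ℚ.+ ε ℚ.≤ seq y n)

_≤ℝ_ : ℝ → ℝ → Set
x ≤ℝ y = ∀ ε → 0ℚ ℚ.< ε → ∃[ N ] (∀ n → N ℕ.≤ n → seq x n ℚ.≤ seq y n ℚ.+ ε)

inv : ∀ p → 0ℚ ℚ.< p → ℚ
inv p 0<p = (ℚ.1/ p) {{ℚ.pos⇒nonZero p {{ℚ.positive 0<p}}}}

abstract
  half : ℚ → ℚ
  half ε = ε ℚ.* ℚ.½

  half-pos : ∀ {ε} → 0ℚ ℚ.< ε → 0ℚ ℚ.< half ε
  half-pos {ε} 0<ε =
    ℚ.positive⁻¹ (half ε) {{ℚ.pos*pos⇒pos ε {{ℚ.positive 0<ε}} ℚ.½}}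

  half+half : ∀ ε → half ε ℚ.+ half ε ≡ ε
  half+half ε = trans (sym (ℚ.*-distribˡ-+ ε ℚ.½ ℚ.½)) (ℚ.*-identityʳ ε)

  +-close : ∀ a b c d {δ} → ∣ a ℚ.- c ∣ ℚ.≤ δ → ∣ b ℚ.- d ∣ ℚ.≤ δ →
    ∣ (a ℚ.+ b) ℚ.- (c ℚ.+ d) ∣ ℚ.≤ δ ℚ.+ δ
  +-close a b c d {δ} a-c≤δ b-d≤δ = begin
    ∣ (a ℚ.+ b) ℚ.- (c ℚ.+ d) ∣    ≡⟨ cong ∣_∣ (regroup a b c d) ⟩
    ∣ (a ℚ.- c) ℚ.+ (b ℚ.- d) ∣    ≤⟨ ℚ.∣p+q∣≤∣p∣+∣q∣ (a ℚ.- c) (b ℚ.- d) ⟩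
    ∣ a ℚ.- c ∣ ℚ.+ ∣ b ℚ.- d ∣    ≤⟨ ℚ.+-mono-≤ a-c≤δ b-d≤δ ⟩
    δ ℚ.+ δ                        ∎
    where
    open ℚ.≤-Reasoning
    open +-*-Solver
    regroup : ∀ a b c d → (a ℚ.+ b) ℚ.- (c ℚ.+ d) ≡ (a ℚ.- c) ℚ.+ (b ℚ.- d)
    regroup = solve 4 (λ a b c d → (a :+ b) :- (c :+ d) := (a :- c) :+ (b :- d)) refl

  eventuallyBounded : ∀ {x} → CauchySeq x →
    ∃[ B ] 0ℚ ℚ.< B × ∃[ N ] (∀ n → N ℕ.≤ n → ∣ x n ∣ ℚ.≤ B)
  eventuallyBounded {x} cx = bound (cx 1ℚ (ℚ.positive⁻¹ 1ℚ))
    where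
    split : ∀ a b → a ≡ (a ℚ.- b) ℚ.+ b
    split = solve 2 (λ a b → a := (a :- b) :+ b) refl
      where open +-*-Solver

    bound : ∃[ N ] (∀ m n → N ℕ.≤ m → N ℕ.≤ n → ∣ x m ℚ.- x n ∣ ℚ.≤ 1ℚ) →
            ∃[ B ] 0ℚ ℚ.< B × ∃[ N ] (∀ n → N ℕ.≤ n → ∣ x n ∣ ℚ.≤ B)
    bound (N , p) = 1ℚ ℚ.+ ∣ x N ∣
                  , ℚ.+-mono-<-≤ (ℚ.positive⁻¹ 1ℚ) (ℚ.0≤∣p∣ (x N))
                  , N , λ n n≥ → begin
      ∣ x n ∣                        ≡⟨ cong ∣_∣ (split (x n) (x N)) ⟩
      ∣ (x n ℚ.- x N) ℚ.+ x N ∣      ≤⟨ ℚ.∣p+q∣≤∣p∣+∣q∣ (x n ℚ.- x N) (x N) ⟩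
      ∣ x n ℚ.- x N ∣ ℚ.+ ∣ x N ∣    ≤⟨ ℚ.+-monoˡ-≤ ∣ x N ∣ (p n N n≥ ℕ.≤-refl) ⟩
      1ℚ ℚ.+ ∣ x N ∣                 ∎
      where open ℚ.≤-Reasoning

  *-mono-≤ : ∀ {p q r s} → 0ℚ ℚ.≤ q → 0ℚ ℚ.≤ r →
             p ℚ.≤ r → q ℚ.≤ s → p ℚ.* q ℚ.≤ r ℚ.* s
  *-mono-≤ {p} {q} {r} {s} 0≤q 0≤r p≤r q≤s = ℚ.≤-trans
    (ℚ.*-monoʳ-≤-nonNeg q {{ℚ.nonNegative 0≤q}} p≤r)
    (ℚ.*-monoˡ-≤-nonNeg r {{ℚ.nonNegative 0≤r}} q≤s)

  *-pos : ∀ {p q} → 0ℚ ℚ.< p → 0ℚ ℚ.< q → 0ℚ ℚ.< p ℚ.* q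
  *-pos {p} {q} 0<p 0<q =
    ℚ.positive⁻¹ (p ℚ.* q) {{ℚ.pos*pos⇒pos p {{ℚ.positive 0<p}} q {{ℚ.positive 0<q}}}}

  inv-pos : ∀ p (0<p : 0ℚ ℚ.< p) → 0ℚ ℚ.< inv p 0<p
  inv-pos p 0<p = ℚ.positive⁻¹ (inv p 0<p) {{ℚ.1/pos⇒pos p {{ℚ.positive 0<p}}}}

  inv-inverse : ∀ p (0<p : 0ℚ ℚ.< p) → inv p 0<p ℚ.* p ≡ 1ℚ
  inv-inverse p 0<p = ℚ.*-inverseˡ p {{ℚ.pos⇒nonZero p {{ℚ.positive 0<p}}}}

  *-close : ∀ {B C δ} a b c d → 0ℚ ℚ.< B → 0ℚ ℚ.< C →
    ∣ a ∣ ℚ.≤ B → ∣ d ∣ ℚ.≤ C → ∣ a ℚ.- c ∣ ℚ.≤ δ → ∣ b ℚ.- d ∣ ℚ.≤ δ →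
    ∣ a ℚ.* b ℚ.- c ℚ.* d ∣ ℚ.≤ (B ℚ.+ C) ℚ.* δ
  *-close {B} {C} {δ} a b c d 0<B 0<C a≤B d≤C a-c≤δ b-d≤δ = begin
    ∣ a ℚ.* b ℚ.- c ℚ.* d ∣
      ≡⟨ cong ∣_∣ (regroup a b c d) ⟩
    ∣ a ℚ.* (b ℚ.- d) ℚ.+ d ℚ.* (a ℚ.- c) ∣
      ≤⟨ ℚ.∣p+q∣≤∣p∣+∣q∣ (a ℚ.* (b ℚ.- d)) (d ℚ.* (a ℚ.- c)) ⟩
    ∣ a ℚ.* (b ℚ.- d) ∣ ℚ.+ ∣ d ℚ.* (a ℚ.- c) ∣
      ≡⟨ cong₂ ℚ._+_ (ℚ.∣p*q∣≡∣p∣*∣q∣ a (b ℚ.- d)) (ℚ.∣p*q∣≡∣p∣*∣q∣ d (a ℚ.- c)) ⟩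
    ∣ a ∣ ℚ.* ∣ b ℚ.- d ∣ ℚ.+ ∣ d ∣ ℚ.* ∣ a ℚ.- c ∣
      ≤⟨ ℚ.+-mono-≤ (*-mono-≤ (ℚ.0≤∣p∣ (b ℚ.- d)) (ℚ.<⇒≤ 0<B) a≤B b-d≤δ)
                    (*-mono-≤ (ℚ.0≤∣p∣ (a ℚ.- c)) (ℚ.<⇒≤ 0<C) d≤C a-c≤δ) ⟩
    B ℚ.* δ ℚ.+ C ℚ.* δ
      ≡⟨ ℚ.*-distribʳ-+ δ B C ⟨
    (B ℚ.+ C) ℚ.* δ ∎
    where
    open ℚ.≤-Reasoning
    open +-*-Solver
    regroup : ∀ a b c d → a ℚ.* b ℚ.- c ℚ.* d ≡ a ℚ.* (b ℚ.- d) ℚ.+ d ℚ.* (a ℚ.- c)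
    regroup = solve 4 (λ a b c d → a :* b :- c :* d := a :* (b :- d) :+ d :* (a :- c)) refl

  p*[inv*q] : ∀ p q (0<p : 0ℚ ℚ.< p) → p ℚ.* (inv p 0<p ℚ.* q) ≡ q
  p*[inv*q] p q 0<p = begin
    p ℚ.* (inv p 0<p ℚ.* q)    ≡⟨ ℚ.*-assoc p (inv p 0<p) q ⟨
    (p ℚ.* inv p 0<p) ℚ.* q    ≡⟨ cong (ℚ._* q) (ℚ.*-comm p (inv p 0<p)) ⟩
    (inv p 0<p ℚ.* p) ℚ.* q    ≡⟨ cong (ℚ._* q) (inv-inverse p 0<p) ⟩
    1ℚ ℚ.* q                   ≡⟨ ℚ.*-identityˡ q ⟩
    q                          ∎
    where open ≡-Reasoning

  inv-antitone : ∀ p q 0<p 0<q → p ℚ.≤ q → inv q 0<q ℚ.≤ inv p 0<p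
  inv-antitone p q 0<p 0<q p≤q = begin
    q⁻¹                      ≡⟨ p*[inv*q] p q⁻¹ 0<p ⟨
    p ℚ.* (p⁻¹ ℚ.* q⁻¹)      ≤⟨ ℚ.*-monoʳ-≤-nonNeg (p⁻¹ ℚ.* q⁻¹)
                                  {{ℚ.nonNegative (ℚ.<⇒≤ (*-pos (inv-pos p 0<p) (inv-pos q 0<q)))}} p≤q ⟩
    q ℚ.* (p⁻¹ ℚ.* q⁻¹)      ≡⟨ cong (q ℚ.*_) (ℚ.*-comm p⁻¹ q⁻¹) ⟩
    q ℚ.* (q⁻¹ ℚ.* p⁻¹)      ≡⟨ p*[inv*q] q p⁻¹ 0<q ⟩
    p⁻¹                      ∎
    where
    open ℚ.≤-Reasoning
    p⁻¹ q⁻¹ : ℚ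
    p⁻¹ = inv p 0<p
    q⁻¹ = inv q 0<q

  inv-difference : ∀ a b a⁻¹ b⁻¹ → a⁻¹ ℚ.* a ≡ 1ℚ → b⁻¹ ℚ.* b ≡ 1ℚ →
                   a⁻¹ ℚ.- b⁻¹ ≡ (a⁻¹ ℚ.* b⁻¹) ℚ.* (b ℚ.- a)
  inv-difference a b a⁻¹ b⁻¹ pa pb = sym (begin
    (a⁻¹ ℚ.* b⁻¹) ℚ.* (b ℚ.- a)
      ≡⟨ regroup a b a⁻¹ b⁻¹ ⟩
    a⁻¹ ℚ.* (b⁻¹ ℚ.* b) ℚ.- b⁻¹ ℚ.* (a⁻¹ ℚ.* a)
      ≡⟨ cong₂ (λ s t → a⁻¹ ℚ.* s ℚ.- b⁻¹ ℚ.* t) pb pa ⟩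
    a⁻¹ ℚ.* 1ℚ ℚ.- b⁻¹ ℚ.* 1ℚ
      ≡⟨ cong₂ ℚ._-_ (ℚ.*-identityʳ a⁻¹) (ℚ.*-identityʳ b⁻¹) ⟩
    a⁻¹ ℚ.- b⁻¹ ∎)
    where
    open ≡-Reasoning
    open +-*-Solver
    regroup : ∀ a b c d → (c ℚ.* d) ℚ.* (b ℚ.- a) ≡ c ℚ.* (d ℚ.* b) ℚ.- d ℚ.* (c ℚ.* a)
    regroup = solve 4 (λ a b c d → (c :* d) :* (b :- a) := c :* (d :* b) :- d :* (c :* a)) refl

  inv-close : ∀ {ε η a b} (0<ε : 0ℚ ℚ.< ε) (0<a : 0ℚ ℚ.< a) (0<b : 0ℚ ℚ.< b) →
    ε ℚ.≤ a → ε ℚ.≤ b → ∣ b ℚ.- a ∣ ℚ.≤ ε ℚ.* (ε ℚ.* η) →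
    ∣ inv a 0<a ℚ.- inv b 0<b ∣ ℚ.≤ η
  inv-close {ε} {η} {a} {b} 0<ε 0<a 0<b ε≤a ε≤b close = begin
    ∣ a⁻¹ ℚ.- b⁻¹ ∣
      ≡⟨ cong ∣_∣ (inv-difference a b a⁻¹ b⁻¹ (inv-inverse a 0<a) (inv-inverse b 0<b)) ⟩
    ∣ (a⁻¹ ℚ.* b⁻¹) ℚ.* (b ℚ.- a) ∣
      ≡⟨ ℚ.∣p*q∣≡∣p∣*∣q∣ (a⁻¹ ℚ.* b⁻¹) (b ℚ.- a) ⟩
    ∣ a⁻¹ ℚ.* b⁻¹ ∣ ℚ.* ∣ b ℚ.- a ∣
      ≡⟨ cong (ℚ._* ∣ b ℚ.- a ∣) (ℚ.0≤p⇒∣p∣≡p (ℚ.<⇒≤ (*-pos (inv-pos a 0<a) (inv-pos b 0<b)))) ⟩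
    (a⁻¹ ℚ.* b⁻¹) ℚ.* ∣ b ℚ.- a ∣
      ≤⟨ *-mono-≤ (ℚ.0≤∣p∣ (b ℚ.- a)) (ℚ.<⇒≤ (*-pos (inv-pos ε 0<ε) (inv-pos ε 0<ε)))
           (*-mono-≤ (ℚ.<⇒≤ (inv-pos b 0<b)) (ℚ.<⇒≤ (inv-pos ε 0<ε))
             (inv-antitone ε a 0<ε 0<a ε≤a) (inv-antitone ε b 0<ε 0<b ε≤b))
           close ⟩
    (ε⁻¹ ℚ.* ε⁻¹) ℚ.* (ε ℚ.* (ε ℚ.* η))
      ≡⟨ regroup ε⁻¹ ε η ⟩
    ε ℚ.* (ε⁻¹ ℚ.* (ε ℚ.* (ε⁻¹ ℚ.* η)))
      ≡⟨ p*[inv*q] ε (ε ℚ.* (ε⁻¹ ℚ.* η)) 0<ε ⟩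
    ε ℚ.* (ε⁻¹ ℚ.* η)
      ≡⟨ p*[inv*q] ε η 0<ε ⟩
    η ∎
    where
    open ℚ.≤-Reasoning
    open +-*-Solver
    a⁻¹ b⁻¹ ε⁻¹ : ℚ
    a⁻¹ = inv a 0<a
    b⁻¹ = inv b 0<b
    ε⁻¹ = inv ε 0<ε
    regroup : ∀ e d h → (e ℚ.* e) ℚ.* (d ℚ.* (d ℚ.* h)) ≡ d ℚ.* (e ℚ.* (d ℚ.* (e ℚ.* h)))
    regroup = solve 3 (λ e d h → (e :* e) :* (d :* (d :* h)) := d :* (e :* (d :* (e :* h)))) refl

  const-cauchy : ∀ q → CauchySeq (λ _ → q)
  const-cauchy q ε 0<ε = 0 , λ _ _ _ _ →
    subst (ℚ._≤ ε) (sym (cong ∣_∣ (ℚ.+-inverseʳ q))) (ℚ.<⇒≤ 0<ε)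

  +-cauchy : ∀ {x y} → CauchySeq x → CauchySeq y → CauchySeq (λ n → x n ℚ.+ y n)
  +-cauchy {x} {y} cx cy ε 0<ε = combine (cx (half ε) (half-pos 0<ε)) (cy (half ε) (half-pos 0<ε))
    where
    combine : ∃[ N ] (∀ m n → N ℕ.≤ m → N ℕ.≤ n → ∣ x m ℚ.- x n ∣ ℚ.≤ half ε) →
              ∃[ M ] (∀ m n → M ℕ.≤ m → M ℕ.≤ n → ∣ y m ℚ.- y n ∣ ℚ.≤ half ε) →
              ∃[ K ] (∀ m n → K ℕ.≤ m → K ℕ.≤ n → ∣ (x m ℚ.+ y m) ℚ.- (x n ℚ.+ y n) ∣ ℚ.≤ ε)
    combine (N , p) (M , q) = N ℕ.⊔ M , λ m n m≥ n≥ → ℚ.≤-trans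
      (+-close (x m) (y m) (x n) (y n)
        (p m n (ℕ.m⊔n≤o⇒m≤o N M m≥) (ℕ.m⊔n≤o⇒m≤o N M n≥))
        (q m n (ℕ.m⊔n≤o⇒n≤o N M m≥) (ℕ.m⊔n≤o⇒n≤o N M n≥)))
      (ℚ.≤-reflexive (half+half ε))

  *-cauchy : ∀ {x y} → CauchySeq x → CauchySeq y → CauchySeq (λ n → x n ℚ.* y n)
  *-cauchy {x} {y} cx cy ε 0<ε = bounded (eventuallyBounded cx) (eventuallyBounded cy)
    where
    Result : Set
    Result = ∃[ N ] (∀ m n → N ℕ.≤ m → N ℕ.≤ n → ∣ x m ℚ.* y m ℚ.- x n ℚ.* y n ∣ ℚ.≤ ε)

    combine : ∀ {B C δ K L} → 0ℚ ℚ.< B → 0ℚ ℚ.< C → (B ℚ.+ C) ℚ.* δ ≡ ε →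
      (∀ n → K ℕ.≤ n → ∣ x n ∣ ℚ.≤ B) → (∀ n → L ℕ.≤ n → ∣ y n ∣ ℚ.≤ C) →
      ∃[ N ] (∀ m n → N ℕ.≤ m → N ℕ.≤ n → ∣ x m ℚ.- x n ∣ ℚ.≤ δ) →
      ∃[ M ] (∀ m n → M ℕ.≤ m → M ℕ.≤ n → ∣ y m ℚ.- y n ∣ ℚ.≤ δ) →
      Result
    combine {K = K} {L} 0<B 0<C eq x≤B y≤C (N , p) (M , q) =
      (K ℕ.⊔ L) ℕ.⊔ (N ℕ.⊔ M) , λ m n m≥ n≥ →
      let m≥KL = ℕ.m⊔n≤o⇒m≤o (K ℕ.⊔ L) (N ℕ.⊔ M) m≥
          n≥KL = ℕ.m⊔n≤o⇒m≤o (K ℕ.⊔ L) (N ℕ.⊔ M) n≥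
          m≥NM = ℕ.m⊔n≤o⇒n≤o (K ℕ.⊔ L) (N ℕ.⊔ M) m≥
          n≥NM = ℕ.m⊔n≤o⇒n≤o (K ℕ.⊔ L) (N ℕ.⊔ M) n≥
      in ℚ.≤-trans
        (*-close (x m) (y m) (x n) (y n) 0<B 0<C
          (x≤B m (ℕ.m⊔n≤o⇒m≤o K L m≥KL)) (y≤C n (ℕ.m⊔n≤o⇒n≤o K L n≥KL))
          (p m n (ℕ.m⊔n≤o⇒m≤o N M m≥NM) (ℕ.m⊔n≤o⇒m≤o N M n≥NM))
          (q m n (ℕ.m⊔n≤o⇒n≤o N M m≥NM) (ℕ.m⊔n≤o⇒n≤o N M n≥NM)))
        (ℚ.≤-reflexive eq)

    scaled : ∀ {B C δ K L} → 0ℚ ℚ.< B → 0ℚ ℚ.< C → 0ℚ ℚ.< δ → (B ℚ.+ C) ℚ.* δ ≡ ε →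
      (∀ n → K ℕ.≤ n → ∣ x n ∣ ℚ.≤ B) → (∀ n → L ℕ.≤ n → ∣ y n ∣ ℚ.≤ C) → Result
    scaled {δ = δ} 0<B 0<C 0<δ eq x≤B y≤C = combine 0<B 0<C eq x≤B y≤C (cx δ 0<δ) (cy δ 0<δ)

    bounded : ∃[ B ] 0ℚ ℚ.< B × ∃[ K ] (∀ n → K ℕ.≤ n → ∣ x n ∣ ℚ.≤ B) →
              ∃[ C ] 0ℚ ℚ.< C × ∃[ L ] (∀ n → L ℕ.≤ n → ∣ y n ∣ ℚ.≤ C) → Result
    bounded (B , 0<B , K , x≤B) (C , 0<C , L , y≤C) =
      scaled 0<B 0<C (*-pos (inv-pos (B ℚ.+ C) 0<B+C) 0<ε) (p*[inv*q] (B ℚ.+ C) ε 0<B+C) x≤B y≤C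
      where
      0<B+C : 0ℚ ℚ.< B ℚ.+ C
      0<B+C = ℚ.+-mono-< 0<B 0<C

  0<⊔ : ∀ {ε} → 0ℚ ℚ.< ε → ∀ a → 0ℚ ℚ.< a ℚ.⊔ ε
  0<⊔ {ε} 0<ε a = ℚ.<-≤-trans 0<ε (ℚ.p≤q⊔p a ε)

  inv-cauchy : ∀ {x ε} (0<ε : 0ℚ ℚ.< ε) → CauchySeq x →
    ∃[ N ] (∀ n → N ℕ.≤ n → 0ℚ ℚ.+ ε ℚ.≤ x n) →
    CauchySeq (λ n → inv (x n ℚ.⊔ ε) (0<⊔ 0<ε (x n)))
  inv-cauchy {x} {ε} 0<ε cx (K , 0+ε≤x) η 0<η =
    combine (cx (ε ℚ.* (ε ℚ.* η)) (*-pos 0<ε (*-pos 0<ε 0<η)))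
    where
    x⊔ε≡x : ∀ n → K ℕ.≤ n → x n ℚ.⊔ ε ≡ x n
    x⊔ε≡x n n≥ = ℚ.p≥q⇒p⊔q≡p (subst (ℚ._≤ x n) (ℚ.+-identityˡ ε) (0+ε≤x n n≥))

    combine : ∃[ N ] (∀ m n → N ℕ.≤ m → N ℕ.≤ n → ∣ x m ℚ.- x n ∣ ℚ.≤ ε ℚ.* (ε ℚ.* η)) →
      ∃[ M ] (∀ m n → M ℕ.≤ m → M ℕ.≤ n →
        ∣ inv (x m ℚ.⊔ ε) (0<⊔ 0<ε (x m)) ℚ.- inv (x n ℚ.⊔ ε) (0<⊔ 0<ε (x n)) ∣ ℚ.≤ η)
    combine (N , p) = K ℕ.⊔ N , λ m n m≥ n≥ →
      inv-close 0<ε (0<⊔ 0<ε (x m)) (0<⊔ 0<ε (x n)) (ℚ.p≤q⊔p (x m) ε) (ℚ.p≤q⊔p (x n) ε)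
        (subst₂ (λ a b → ∣ b ℚ.- a ∣ ℚ.≤ ε ℚ.* (ε ℚ.* η))
          (sym (x⊔ε≡x m (ℕ.m⊔n≤o⇒m≤o K N m≥)))
          (sym (x⊔ε≡x n (ℕ.m⊔n≤o⇒m≤o K N n≥)))
          (p n m (ℕ.m⊔n≤o⇒n≤o K N n≥) (ℕ.m⊔n≤o⇒n≤o K N m≥)))

fromℚ : ℚ → ℝ
fromℚ q = mkℝ (λ _ → q) (const-cauchy q)

0ℝ 4ℝ : ℝ
0ℝ = fromℚ 0ℚ
4ℝ = fromℚ (+ 4 ℚ./ 1)

_+ℝ_ _*ℝ_ : ℝ → ℝ → ℝ
mkℝ x cx +ℝ mkℝ y cy = mkℝ (λ n → x n ℚ.+ y n) (+-cauchy {x} {y} cx cy)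
mkℝ x cx *ℝ mkℝ y cy = mkℝ (λ n → x n ℚ.* y n) (*-cauchy {x} {y} cx cy)

-- The reciprocal of a positive real x ≥ ε > 0.  Finitely many x n may lie
-- below ε; these are replaced by ε to make every term invertible.
recip : (x : ℝ) → 0ℝ <ℝ x → ℝ
recip (mkℝ x cx) (ε , 0<ε , ε≤x) =
  mkℝ (λ n → inv (x n ℚ.⊔ ε) (0<⊔ 0<ε (x n))) (inv-cauchy {x} 0<ε cx ε≤x)

------------------------------------------------------------------------
-- Instances

record Instance : Set₁ where
  field
    Item          : Set
    _≟_           : DecidableEquality Item
    weight        : Item → ℝ
    weight-nonNeg : ∀ x → 0ℝ ≤ℝ weight x

  Element : Set
  Element = Item × ℕ

  -- Finite sets of items and of elements are duplicate-free lists.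

  ν : List Item → ℝ
  ν X = foldr (λ x s → weight x +ℝ s) 0ℝ X

  f : List Element → ℝ
  f S = ν (deduplicate _≟_ (map proj₁ S))

  inPart : ℕ → List Element → List Element
  inPart i = filter (λ e → proj₂ e ℕ.≟ i)

  Independent : List Element → Set
  Independent S = ∀ i → length (inPart i S) ℕ.≤ 1

  independent? : ∀ S → Dec (Independent S)
  independent? S =
    map′ everywhere (λ ind → All.tabulate (λ {e} _ → ind (proj₂ e)))
      (All.all? (λ e → length (inPart (proj₂ e) S) ℕ.≤? 1) S)
    where
    everywhere : All.All (λ e → length (inPart (proj₂ e) S) ℕ.≤ 1) S → Independent S
    everywhere occ i with any? (λ e → proj₂ e ℕ.≟ i) S
    ... | yes i∈S = subst (λ j → length (inPart j S) ℕ.≤ 1)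
      (proj₂ (All.lookupAny occ i∈S)) (proj₁ (All.lookupAny occ i∈S))
    ... | no  i∉S = subst (λ T → length T ℕ.≤ 1)
      (sym (filter-none (λ e → proj₂ e ℕ.≟ i) (¬Any⇒All¬ S i∉S))) ℕ.z≤n

  -- An arrival sequence is listed with the most recent element first, so that
  -- its prefixes in time are its tails.  Sets of arrived elements are subsets
  -- of the positions.
  select : ∀ {n} → Vec Element n → Subset n → List Element
  select []       []            = []
  select (e ∷ es) (inside  ∷ S) = e ∷ select es S
  select (e ∷ es) (outside ∷ S) = select es S

  value : ∀ {n} → Vec Element n → Subset n → ℝ
  value es S = f (select es S)

  Indep : ∀ {n} → Vec Element n → Subset n → Set
  Indep es S = Independent (select es S)

  indepOracle : ∀ {n} → Vec Element n → Subset n → Bool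
  indepOracle es S = does (independent? (select es S))

  IsOPT : ∀ {n} → Vec Element n → Subset n → Set
  IsOPT es O = Indep es O × (∀ T → Indep es T → value es T ≤ℝ value es O)

open Instance public

------------------------------------------------------------------------
-- Deterministic online algorithms with free disposal

-- On the arrival of the (n + 1)-st element: whether to include it, and which
-- of the current elements to keep.  The elements are seen only through their
-- arrival times and through the two oracles on sets of arrived elements.  A
-- rule may depend on the Cauchy sequences representing the values, which only
-- enlarges the class of algorithms.
Rule : Set
Rule = ∀ n → (valueOracle : Subset (suc n) → ℝ)
           → (independenceOracle : Subset (suc n) → Bool)
           → (current : Subset n)
           → Side × Subset n

run : Rule → (I : Instance) → ∀ {n} → Vec (Element I) n → Subset n
run rule I []                 = []
run rule I {suc n} (e ∷ es) = proj₁ decision ∷ (proj₂ decision ∩ run rule I es)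
  where
  decision : Side × Subset n
  decision = rule n (value I (e ∷ es)) (indepOracle I (e ∷ es)) (run rule I es)

record Algorithm : Set₁ where
  field
    rule     : Rule
    feasible : ∀ (I : Instance) {n} (es : Vec (Element I) n) → Unique es →
               Indep I es (run rule I es)

  solution : (I : Instance) → ∀ {n} → Vec (Element I) n → Subset n
  solution = run rule

open Algorithm public

StrictlyMonotone : Algorithm → Set₁
StrictlyMonotone A =
  ∀ (I : Instance) {n} (e : Element I) (es : Vec (Element I) n) → Unique (e ∷ es) →
  Vec.head (solution A I (e ∷ es)) ≡ inside →
  value I es (solution A I es) <ℝ value I (e ∷ es) (solution A I (e ∷ es))

HasCompetitiveRatio : Algorithm → ℝ → Set₁
HasCompetitiveRatio A r =
  ∀ (I : Instance) {n} (es : Vec (Element I) n) → Unique es →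
  ∀ O → IsOPT I es O → r *ℝ value I es O ≤ℝ value I es (solution A I es)

module Submission where

-- The idea.  Give the items positive weights w 0, w 1, … and let the elements
-- arrive in the order
--
--   (0 , 0), (0 , 1), (1 , 0), (1 , 2), (2 , 0), (2 , 3), …
--
-- All elements (k , 0) compete for part 0, whereas the copy (k , k + 1) of
-- item k has a part of its own.  When the copy arrives, an algorithm that
-- holds item k cannot take it, because that would not increase the value.
-- So a strictly monotone algorithm that holds just (k , 0) still holds at
-- most that element when (k + 1 , 0) arrives, and must then choose between
-- w k and w (k + 1), while the optimum collects w 0 + … + w (k + 1): the
-- copies of the earlier items together with the new element.
--
-- Suppose the ratio exceeds 1 / q and the weights satisfy
-- w 0 + … + w (k + 1) ≥ q w k.  Rejecting (k + 1 , 0) would then leave the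
-- algorithm with too little, so it must always exchange (k , 0) for
-- (k + 1 , 0) (replaces), and strict monotonicity makes the weights strictly
-- increasing (rising).
--
-- For q < 4 the weights can be chosen so that this is impossible.  Write
-- T k = w 0 + … + w k and set w (k + 1) = max (w k, q w k − T k).  If the
-- weights increased for ever, then T (k + 1) = q w k for all k, and with
-- δ = 1 − q / 4 the quotient T k / w k would grow by at least δ in each step
-- (ratio-rises), although it never exceeds q (not-always-rising).
--
-- A real α < 4 lies eventually below a rational q = 4 (1 − δ), and 1 / α < r
-- provides a rational c with c q > 1 that is eventually below r; thus the
-- whole argument takes place in the rationals.

open import Defs
open import Data.Product.Base using (Σ-syntax; _×_)
open import Relation.Nullary using (¬_)

open import Data.Empty using (⊥-elim)
open import Data.Fin.Subset using (Subset; Side; inside; outside; _∩_)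
open import Data.Integer.Base as ℤ using (+_; -[1+_])
import Data.Integer.Properties as ℤ
open import Data.List.Base
  using (List; []; _∷_; [_]; _++_; map; foldr; downFrom; length; deduplicate)
open import Data.List.Membership.Propositional using (_∈_)
open import Data.List.Membership.Propositional.Properties
  using (∈-∃++; ∈-++⁻; ∈-++⁺ˡ; ∈-++⁺ʳ; ∈-downFrom⁺; ∈-deduplicate⁻; ∈-deduplicate⁺; ∈-map⁻)
open import Data.List.Properties using (filter-none; filter-accept; filter-reject; map-∘; map-id)
open import Data.List.Relation.Binary.Sublist.Propositional using ([]; _∷_; _∷ʳ_)
  renaming (_⊆_ to Sublist)
open import Data.List.Relation.Binary.Subset.Propositional using (_⊆_)
open import Data.List.Relation.Unary.All as All using (All; []; _∷_)
import Data.List.Relation.Unary.All.Properties as All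
open import Data.List.Relation.Unary.AllPairs as AllPairs using ([]; _∷_)
open import Data.List.Relation.Unary.Any using (here; there)
import Data.List.Relation.Unary.Unique.Propositional as List
open import Data.List.Relation.Unary.Unique.Propositional.Properties using (downFrom⁺; map⁺)
open import Data.Nat.Base as ℕ using (ℕ; zero; suc; z≤n; s≤s)
import Data.Nat.Properties as ℕ
open import Data.List.Relation.Unary.Unique.DecPropositional.Properties ℕ._≟_ using (deduplicate-!)
open import Data.Product.Base using (∃-syntax; _,_; proj₁; proj₂)
open import Data.Rational.Base as ℚ using (ℚ; 0ℚ; 1ℚ; _⊔_; positive; nonNegative)
import Data.Rational.Properties as ℚ
open import Data.Rational.Solver using (module +-*-Solver)
import Data.Rational.Unnormalised.Base as ℚᵘ
import Data.Rational.Unnormalised.Properties as ℚᵘ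
open import Data.Sum.Base using (_⊎_; inj₁; inj₂)
open import Data.Vec.Base as Vec using (Vec; []; _∷_)
import Data.Vec.Relation.Unary.All as VecAll
open import Data.Vec.Relation.Unary.All using ([]; _∷_)
open import Data.Vec.Relation.Unary.AllPairs using ([]; _∷_)
open import Data.Vec.Relation.Unary.Unique.Propositional using (Unique)
open import Function.Base using (_∘_)
open import Relation.Binary.PropositionalEquality
  using (_≡_; _≢_; refl; sym; trans; cong; subst; subst₂)
open import Relation.Nullary using (yes; no)

-- Rational arithmetic

natℚ : ℕ → ℚ
natℚ n = + n ℚ./ 1

natℚ-suc : ∀ n → natℚ (suc n) ≡ 1ℚ ℚ.+ natℚ n
natℚ-suc n = ℚ.toℚᵘ-injective (begin
  ℚ.toℚᵘ (natℚ (suc n))              ≈⟨ ℚ.toℚᵘ-fromℚᵘ (ℚᵘ.mkℚᵘ (+ suc n) 0) ⟩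
  ℚᵘ.mkℚᵘ (+ suc n) 0                ≈⟨ ℚᵘ.*≡* (cong (λ i → (+ 1 ℤ.+ i) ℤ.* + 1) (sym (ℤ.*-identityʳ (+ n)))) ⟩
  ℚᵘ.1ℚᵘ ℚᵘ.+ ℚᵘ.mkℚᵘ (+ n) 0        ≈⟨ ℚᵘ.+-congʳ ℚᵘ.1ℚᵘ (ℚ.toℚᵘ-fromℚᵘ (ℚᵘ.mkℚᵘ (+ n) 0)) ⟨
  ℚ.toℚᵘ 1ℚ ℚᵘ.+ ℚ.toℚᵘ (natℚ n)     ≈⟨ ℚ.toℚᵘ-homo-+ 1ℚ (natℚ n) ⟨
  ℚ.toℚᵘ (1ℚ ℚ.+ natℚ n)             ∎)
  where open ℚᵘ.≃-Reasoning

-- The Archimedean property: a nonnegative fraction is at most its numerator,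
-- because its denominator is at least 1.
≤natℚ : ∀ p → ∃[ n ] p ℚ.≤ natℚ n
≤natℚ p@(ℚ.mkℚ (+ a) d _) = a , ℚ.toℚᵘ-cancel-≤
  (ℚᵘ.≤-respʳ-≃ (ℚᵘ.≃-sym (ℚ.toℚᵘ-fromℚᵘ (ℚᵘ.mkℚᵘ (+ a) 0)))
    (ℚᵘ.*≤* (ℤ.*-monoˡ-≤-nonNeg (+ a) (ℤ.+≤+ (s≤s z≤n)))))
≤natℚ p@(ℚ.mkℚ -[1+ _ ] _ _) = 0 , ℚ.<⇒≤ (ℚ.negative⁻¹ p)

4ℚ : ℚ
4ℚ = + 4 ℚ./ 1

p≤p+q : ∀ p {q} → 0ℚ ℚ.≤ q → p ℚ.≤ p ℚ.+ q
p≤p+q p {q} 0≤q = subst (ℚ._≤ p ℚ.+ q) (ℚ.+-identityʳ p) (ℚ.+-monoʳ-≤ p 0≤q)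

0≤q-p : ∀ {p q} → p ℚ.≤ q → 0ℚ ℚ.≤ q ℚ.- p
0≤q-p {p} {q} p≤q = subst (ℚ._≤ q ℚ.- p) (ℚ.+-inverseʳ p) (ℚ.+-monoˡ-≤ (ℚ.- p) p≤q)

p-q+q≡p : ∀ p q → p ℚ.- q ℚ.+ q ≡ p
p-q+q≡p = solve 2 (λ p q → p :- q :+ q := p) refl
  where open +-*-Solver

*-nonNeg : ∀ {p q} → 0ℚ ℚ.≤ p → 0ℚ ℚ.≤ q → 0ℚ ℚ.≤ p ℚ.* q
*-nonNeg {p} {q} 0≤p 0≤q = subst (ℚ._≤ p ℚ.* q) (ℚ.*-zeroʳ p) (ℚ.*-monoˡ-≤-nonNeg p {{nonNegative 0≤p}} 0≤q)

square-nonNeg : ∀ p → 0ℚ ℚ.≤ p ℚ.* p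
square-nonNeg p with ℚ.≤-total 0ℚ p
... | inj₁ 0≤p = *-nonNeg 0≤p 0≤p
... | inj₂ p≤0 = subst (ℚ._≤ p ℚ.* p) (ℚ.*-zeroʳ p) (ℚ.*-monoˡ-≤-nonPos p {{ℚ.nonPositive p≤0}} p≤0)

-- Real numbers represented by constant sequences

-- An algorithm's guarantees compare real values; here those values are given by
-- constant sequences, so the comparison descends to the rationals.
<ℝ⇒< : ∀ {X Y x y} → (∀ n → seq X n ≡ x) → (∀ n → seq Y n ≡ y) → X <ℝ Y → x ℚ.< y
<ℝ⇒< {X} {Y} {x} {y} X≡x Y≡y (ε , 0<ε , N , X+ε≤Y) = begin-strict
  x                  ≡⟨ ℚ.+-identityʳ x ⟨
  x ℚ.+ 0ℚ           <⟨ ℚ.+-monoʳ-< x 0<ε ⟩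
  x ℚ.+ ε            ≡⟨ cong (ℚ._+ ε) (X≡x N) ⟨
  seq X N ℚ.+ ε      ≤⟨ X+ε≤Y N ℕ.≤-refl ⟩
  seq Y N            ≡⟨ Y≡y N ⟩
  y                  ∎
  where open ℚ.≤-Reasoning

-- The left side need only be eventually above x, since the competitive ratio is
-- an arbitrary real.  If y < x, then a rational m strictly between them gives
-- the tolerance m − y, which refutes X ≤ Y.
≤ℝ⇒≤ : ∀ {X Y x y} → ∃[ N ] (∀ n → N ℕ.≤ n → x ℚ.≤ seq X n) → (∀ n → seq Y n ≡ y) →
  X ≤ℝ Y → x ℚ.≤ y
≤ℝ⇒≤ {X} {Y} {x} {y} (N , x≤X) Y≡y X≤Y = ℚ.≮⇒≥ λ y<x →
  let m , y<m , m<x = ℚ.<-dense y<x in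
  ℚ.<-irrefl refl (ℚ.<-≤-trans m<x (x≤between m y<m))
  where
  open ℚ.≤-Reasoning
  cancel : ∀ a b → a ℚ.+ (b ℚ.- a) ≡ b
  cancel = solve 2 (λ a b → a :+ (b :- a) := b) refl
    where open +-*-Solver
  x≤between : ∀ m → y ℚ.< m → x ℚ.≤ m
  x≤between m y<m =
    let M , X≤Y+ = X≤Y (m ℚ.- y) (subst (ℚ._< m ℚ.- y) (ℚ.+-inverseʳ y) (ℚ.+-monoˡ-< (ℚ.- y) y<m))
        k = N ℕ.⊔ M
    in begin
      x                           ≤⟨ x≤X k (ℕ.m≤m⊔n N M) ⟩
      seq X k                     ≤⟨ X≤Y+ k (ℕ.m≤n⊔m N M) ⟩
      seq Y k ℚ.+ (m ℚ.- y)       ≡⟨ cong (ℚ._+ (m ℚ.- y)) (Y≡y k) ⟩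
      y ℚ.+ (m ℚ.- y)             ≡⟨ cancel y m ⟩
      m                           ∎

≤⇒≤ℝ : ∀ {X Y x y} → (∀ n → seq X n ≡ x) → (∀ n → seq Y n ≡ y) → x ℚ.≤ y → X ≤ℝ Y
≤⇒≤ℝ X≡x Y≡y x≤y ε 0<ε = 0 , λ n _ →
  subst₂ (λ x y → x ℚ.≤ y ℚ.+ ε) (sym (X≡x n)) (sym (Y≡y n)) (ℚ.≤-trans x≤y (p≤p+q _ (ℚ.<⇒≤ 0<ε)))

-- Weights that cannot increase for ever

module Growth (δ : ℚ) (0<δ : 0ℚ ℚ.< δ) where
  q : ℚ
  q = 4ℚ ℚ.* (1ℚ ℚ.- δ)

  -- If S is a prefix sum with last term v and q v is the next prefix sum, with
  -- last term w, then S / v ≥ y implies (q v) / w ≥ y + δ.  With denominators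
  -- cleared, the difference of the two sides is a sum of nonnegative terms, one
  -- of them the square of w − (q / 2) v: the discriminant of w² − q v w + q v²
  -- is q (q − 4) v², and q < 4 leaves the surplus that pays for δ.
  ratio-rises : ∀ y v w → 0ℚ ℚ.< v → 0ℚ ℚ.≤ w → w ℚ.≤ q ℚ.* v →
    y ℚ.* v ℚ.+ w ℚ.≤ q ℚ.* v → (y ℚ.+ δ) ℚ.* w ℚ.≤ q ℚ.* v
  ratio-rises y v w 0<v 0≤w w≤qv yv+w≤qv =
    ℚ.*-cancelʳ-≤-pos v {{positive 0<v}} (ℚ.≤-trans (p≤p+q _ 0≤rest) (ℚ.≤-reflexive (identity δ y v w)))
    where
    h : ℚ
    h = w ℚ.- (1ℚ ℚ.+ 1ℚ) ℚ.* (1ℚ ℚ.- δ) ℚ.* v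
    rest : ℚ
    rest = (q ℚ.* v ℚ.- (y ℚ.* v ℚ.+ w)) ℚ.* w ℚ.+ (h ℚ.* h ℚ.+ (δ ℚ.* v) ℚ.* (q ℚ.* v ℚ.- w))
    0≤rest : 0ℚ ℚ.≤ rest
    0≤rest = ℚ.+-mono-≤ (*-nonNeg (0≤q-p yv+w≤qv) 0≤w)
      (ℚ.+-mono-≤ (square-nonNeg h) (*-nonNeg (*-nonNeg (ℚ.<⇒≤ 0<δ) (ℚ.<⇒≤ 0<v)) (0≤q-p w≤qv)))
    identity : ∀ δ y v w →
      let q = 4ℚ ℚ.* (1ℚ ℚ.- δ)
          h = w ℚ.- (1ℚ ℚ.+ 1ℚ) ℚ.* (1ℚ ℚ.- δ) ℚ.* v
      in (y ℚ.+ δ) ℚ.* w ℚ.* v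
           ℚ.+ ((q ℚ.* v ℚ.- (y ℚ.* v ℚ.+ w)) ℚ.* w ℚ.+ (h ℚ.* h ℚ.+ (δ ℚ.* v) ℚ.* (q ℚ.* v ℚ.- w)))
         ≡ q ℚ.* v ℚ.* v
    identity = solve 4 (λ δ y v w →
      let q = con 4ℚ :* (con 1ℚ :- δ)
          h = w :- (con 1ℚ :+ con 1ℚ) :* (con 1ℚ :- δ) :* v
      in (y :+ δ) :* w :* v
           :+ ((q :* v :- (y :* v :+ w)) :* w :+ (h :* h :+ (δ :* v) :* (q :* v :- w)))
         := q :* v :* v) refl
      where open +-*-Solver

  -- The weight w k together with w 0 + … + w (k − 1), on which the next weight
  -- depends as well.
  state : ℕ → ℚ × ℚ
  state zero    = 1ℚ , 0ℚ
  state (suc k) = let v , s = state k in v ⊔ (q ℚ.* v ℚ.- (v ℚ.+ s)) , v ℚ.+ s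

  weights : ℕ → ℚ
  weights k = proj₁ (state k)

  below : ℕ → ℚ
  below k = proj₂ (state k)

  weights-pos : ∀ k → 0ℚ ℚ.< weights k
  weights-pos zero    = ℚ.positive⁻¹ 1ℚ
  weights-pos (suc k) = ℚ.<-≤-trans (weights-pos k) (ℚ.p≤p⊔q _ _)

  -- The second argument of the maximum serves this purpose: with the next item
  -- added, the optimum is large enough to force the exchange.
  below-large : ∀ k → q ℚ.* weights k ℚ.≤ below (2 ℕ.+ k)
  below-large k = begin
    q ℚ.* weights k                                        ≡⟨ p-q+q≡p (q ℚ.* weights k) (below (suc k)) ⟨
    q ℚ.* weights k ℚ.- below (suc k) ℚ.+ below (suc k)    ≤⟨ ℚ.+-monoˡ-≤ (below (suc k)) (ℚ.p≤q⊔p (weights k) _) ⟩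
    below (2 ℕ.+ k)                                        ∎
    where open ℚ.≤-Reasoning

  -- As long as the weights rise, the maximum is attained by its second argument
  -- and the prefix sum through item k + 1 is exactly q w k.  The quotient of the
  -- prefix sum and its last term is then at least 1 + k δ, yet at most q.
  not-always-rising : ¬ (∀ k → weights k ℚ.< weights (suc k))
  not-always-rising rising = ℚ.<-irrefl refl (ℚ.<-≤-trans q<level (level≤q n))
    where
    balanced : ∀ k → weights (suc k) ℚ.+ below (suc k) ≡ q ℚ.* weights k
    balanced k with ℚ.⊔-sel (weights k) (q ℚ.* weights k ℚ.- below (suc k))
    ... | inj₁ eq = ⊥-elim (ℚ.<-irrefl (sym eq) (rising k))
    ... | inj₂ eq = trans (cong (ℚ._+ below (suc k)) eq) (p-q+q≡p (q ℚ.* weights k) (below (suc k)))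

    level : ℕ → ℚ
    level k = 1ℚ ℚ.+ natℚ k ℚ.* δ

    level-suc : ∀ k → level k ℚ.+ δ ≡ level (suc k)
    level-suc k = trans (solve 2 (λ n d → con 1ℚ :+ n :* d :+ d := con 1ℚ :+ (con 1ℚ :+ n) :* d) refl (natℚ k) δ)
                        (cong (λ n → 1ℚ ℚ.+ n ℚ.* δ) (sym (natℚ-suc k)))
      where open +-*-Solver

    0≤below : ∀ k → 0ℚ ℚ.≤ below k
    0≤below zero    = ℚ.≤-refl
    0≤below (suc k) = ℚ.+-mono-≤ (ℚ.<⇒≤ (weights-pos k)) (0≤below k)

    next≤ : ∀ k → weights (suc k) ℚ.≤ q ℚ.* weights k
    next≤ k = subst (weights (suc k) ℚ.≤_) (balanced k) (p≤p+q (weights (suc k)) (0≤below (suc k)))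

    level*weights≤ : ∀ k → level k ℚ.* weights k ℚ.≤ below (suc k)
    level*weights≤ zero    = ℚ.≤-reflexive (solve 1 (λ d → (con 1ℚ :+ con 0ℚ :* d) :* con 1ℚ := con 1ℚ :+ con 0ℚ) refl δ)
      where open +-*-Solver
    level*weights≤ (suc k) = subst₂ (λ y s → y ℚ.* weights (suc k) ℚ.≤ s) (level-suc k) (sym (balanced k))
      (ratio-rises (level k) (weights k) (weights (suc k)) (weights-pos k) (ℚ.<⇒≤ (weights-pos (suc k))) (next≤ k)
        (begin
          level k ℚ.* weights k ℚ.+ weights (suc k)  ≤⟨ ℚ.+-monoˡ-≤ (weights (suc k)) (level*weights≤ k) ⟩
          below (suc k) ℚ.+ weights (suc k)          ≡⟨ ℚ.+-comm (below (suc k)) (weights (suc k)) ⟩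
          weights (suc k) ℚ.+ below (suc k)          ≡⟨ balanced k ⟩
          q ℚ.* weights k                            ∎))
      where open ℚ.≤-Reasoning

    level≤q : ∀ k → level k ℚ.≤ q
    level≤q k = ℚ.*-cancelʳ-≤-pos (weights k) {{positive (weights-pos k)}} (begin
      level k ℚ.* weights k                ≤⟨ level*weights≤ k ⟩
      below (suc k)                        ≤⟨ p≤p+q (below (suc k)) (ℚ.<⇒≤ (weights-pos (suc k))) ⟩
      below (suc k) ℚ.+ weights (suc k)    ≡⟨ ℚ.+-comm (below (suc k)) (weights (suc k)) ⟩
      weights (suc k) ℚ.+ below (suc k)    ≡⟨ balanced k ⟩
      q ℚ.* weights k                      ∎)
      where open ℚ.≤-Reasoning

    n : ℕ
    n = proj₁ (≤natℚ (inv δ 0<δ ℚ.* q))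

    q<level : q ℚ.< level n
    q<level = begin-strict
      q                             ≡⟨ p*[inv*q] δ q 0<δ ⟨
      δ ℚ.* (inv δ 0<δ ℚ.* q)       ≤⟨ ℚ.*-monoˡ-≤-nonNeg δ {{nonNegative (ℚ.<⇒≤ 0<δ)}} (proj₂ (≤natℚ (inv δ 0<δ ℚ.* q))) ⟩
      δ ℚ.* natℚ n                  ≡⟨ ℚ.*-comm δ (natℚ n) ⟩
      natℚ n ℚ.* δ                  ≡⟨ ℚ.+-identityˡ (natℚ n ℚ.* δ) ⟨
      0ℚ ℚ.+ natℚ n ℚ.* δ           <⟨ ℚ.+-monoˡ-< (natℚ n ℚ.* δ) (ℚ.positive⁻¹ 1ℚ) ⟩
      level n                       ∎
      where open ℚ.≤-Reasoning

-- Independent sets and single rounds of an algorithm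

unique⇒independent : ∀ I (S : List (Element I)) → List.Unique (map proj₂ S) → Independent I S
unique⇒independent I []      _            i = z≤n
unique⇒independent I (e ∷ S) (e∉ ∷ uniq) i with proj₂ e ℕ.≟ i
... | no  ≢i   = subst (λ T → length T ℕ.≤ 1) (sym (filter-reject (λ e → proj₂ e ℕ.≟ i) ≢i))
  (unique⇒independent I S uniq i)
... | yes refl = ℕ.≤-reflexive (trans
  (cong length (filter-accept (λ e → proj₂ e ℕ.≟ i) {x = e} {xs = S} refl))
  (cong (suc ∘ length) (filter-none (λ e → proj₂ e ℕ.≟ i) (none S e∉))))
  where
  none : ∀ S → All (i ≢_) (map proj₂ S) → All (λ e → proj₂ e ≢ i) S
  none []      []         = []
  none (_ ∷ S) (i≢ ∷ i∉S) = i≢ ∘ sym ∷ none S i∉S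

held : (A : Algorithm) (I : Instance) → ∀ {n} → Vec (Element I) n → List (Element I)
held A I es = select I es (solution A I es)

select-∩ : ∀ I {n} (es : Vec (Element I) n) D S → Sublist (select I es (D ∩ S)) (select I es S)
select-∩ I []       []            []            = []
select-∩ I (e ∷ es) (inside  ∷ D) (inside  ∷ S) = refl ∷ select-∩ I es D S
select-∩ I (e ∷ es) (outside ∷ D) (inside  ∷ S) = e ∷ʳ select-∩ I es D S
select-∩ I (e ∷ es) (inside  ∷ D) (outside ∷ S) = select-∩ I es D S
select-∩ I (e ∷ es) (outside ∷ D) (outside ∷ S) = select-∩ I es D S

-- All that the argument needs to know about an arbitrary rule: apart from the new
-- element, a solution can only shrink.
round : ∀ A I {n} (e : Element I) (es : Vec (Element I) n) →
  ∃[ K ] Sublist K (held A I es) ×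
    (Vec.head (solution A I (e ∷ es)) ≡ inside × held A I (e ∷ es) ≡ e ∷ K
     ⊎ held A I (e ∷ es) ≡ K)
round A I {n} e es = select I es (kept ∩ solution A I es)
                   , select-∩ I es kept (solution A I es) , cases (proj₁ decision)
  where
  decision : Side × Subset n
  decision = rule A n (value I (e ∷ es)) (indepOracle I (e ∷ es)) (solution A I es)
  kept = proj₂ decision
  rest = kept ∩ solution A I es
  cases : ∀ side → side ≡ inside × select I (e ∷ es) (side ∷ rest) ≡ e ∷ select I es rest
                 ⊎ select I (e ∷ es) (side ∷ rest) ≡ select I es rest
  cases inside  = inj₁ (refl , refl)
  cases outside = inj₂ refl

sublist-of-singleton : ∀ {A : Set} {xs : List A} {y} → Sublist xs [ y ] → xs ≡ [] ⊎ xs ≡ [ y ]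
sublist-of-singleton (_ ∷ʳ [])   = inj₁ refl
sublist-of-singleton (refl ∷ []) = inj₂ refl

-- The instance and its arrival sequence

module Game (w : ℕ → ℚ) (0<w : ∀ k → 0ℚ ℚ.< w k) where

  total : List ℕ → ℚ
  total = foldr (λ x s → w x ℚ.+ s) 0ℚ

  total-insert : ∀ ys x zs → total (ys ++ x ∷ zs) ≡ w x ℚ.+ total (ys ++ zs)
  total-insert []       x zs = refl
  total-insert (y ∷ ys) x zs = trans (cong (w y ℚ.+_) (total-insert ys x zs))
    (swap (w y) (w x) (total (ys ++ zs)))
    where
    swap : ∀ a b c → a ℚ.+ (b ℚ.+ c) ≡ b ℚ.+ (a ℚ.+ c)
    swap = solve 3 (λ a b c → a :+ (b :+ c) := b :+ (a :+ c)) refl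
      where open +-*-Solver

  0≤total : ∀ xs → 0ℚ ℚ.≤ total xs
  0≤total []       = ℚ.≤-refl
  0≤total (x ∷ xs) = ℚ.+-mono-≤ (ℚ.<⇒≤ (0<w x)) (0≤total xs)

  -- This bounds f both from above and from below: the list of the items of a set,
  -- freed of duplicates, is compared with an explicit list through inclusion
  -- alone, so that the deduplication need never be computed.
  total-mono : ∀ {xs} ys → List.Unique xs → xs ⊆ ys → total xs ℚ.≤ total ys
  total-mono ys [] _ = 0≤total ys
  total-mono {x ∷ xs} ys (x∉xs ∷ uniq) xs⊆ys with ∈-∃++ (xs⊆ys (here refl))
  ... | as , bs , refl = subst (total (x ∷ xs) ℚ.≤_) (sym (total-insert as x bs))
    (ℚ.+-monoʳ-≤ (w x) (total-mono (as ++ bs) uniq avoid))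
    where
    avoid : xs ⊆ as ++ bs
    avoid z∈xs with ∈-++⁻ as (xs⊆ys (there z∈xs))
    ... | inj₁ z∈as          = ∈-++⁺ˡ z∈as
    ... | inj₂ (here refl)   = ⊥-elim (All.lookup x∉xs z∈xs refl)
    ... | inj₂ (there z∈bs)  = ∈-++⁺ʳ as z∈bs

  game : Instance
  game = record
    { Item = ℕ ; _≟_ = ℕ._≟_ ; weight = fromℚ ∘ w
    ; weight-nonNeg = λ x → ≤⇒≤ℝ {0ℝ} {fromℚ (w x)} (λ _ → refl) (λ _ → refl) (ℚ.<⇒≤ (0<w x)) }

  worth : List (ℕ × ℕ) → ℚ
  worth S = total (deduplicate ℕ._≟_ (map proj₁ S))

  seq-f : ∀ S n → seq (f game S) n ≡ worth S
  seq-f S n = go (deduplicate ℕ._≟_ (map proj₁ S))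
    where
    go : ∀ xs → seq (ν game xs) n ≡ total xs
    go []       = refl
    go (x ∷ xs) = cong (w x ℚ.+_) (go xs)

  worth-≤ : ∀ S xs → map proj₁ S ⊆ xs → worth S ℚ.≤ total xs
  worth-≤ S xs sub = total-mono xs (deduplicate-! (map proj₁ S))
    (sub ∘ ∈-deduplicate⁻ ℕ._≟_ (map proj₁ S))

  worth-≥ : ∀ S xs → List.Unique xs → xs ⊆ map proj₁ S → total xs ℚ.≤ worth S
  worth-≥ S xs uniq sub = total-mono _ uniq (∈-deduplicate⁺ ℕ._≟_ ∘ sub)

  -- Any number of copies of one item counts only once.
  worth-copies : ∀ x S → All (λ e → proj₁ e ≡ x) S → worth S ℚ.≤ w x
  worth-copies x S all≡ = ℚ.≤-trans
    (worth-≤ S [ x ] (λ y∈ → let _ , e∈ , y≡ = ∈-map⁻ proj₁ y∈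
                             in here (trans y≡ (All.lookup all≡ e∈))))
    (ℚ.≤-reflexive (ℚ.+-identityʳ (w x)))

  worth-single : ∀ x i → worth [ (x , i) ] ≡ w x
  worth-single x i = ℚ.+-identityʳ (w x)

  copies-of : ∀ {x i : ℕ} {K} → K ≡ [] ⊎ K ≡ [ (x , i) ] → All (λ e → proj₁ e ≡ x) K
  copies-of (inj₁ refl) = []
  copies-of (inj₂ refl) = refl ∷ []

  len : ℕ → ℕ
  len zero    = 1
  len (suc k) = suc (suc (len k))

  -- arrivals k ends with the arrival of (k , 0), and withCopy k with that of the
  -- copy (k , k + 1).  The most recent element comes first.
  mutual
    arrivals : ∀ k → Vec (ℕ × ℕ) (len k)
    arrivals zero    = (0 , 0) ∷ []
    arrivals (suc k) = (suc k , 0) ∷ withCopy k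

    withCopy : ∀ k → Vec (ℕ × ℕ) (suc (len k))
    withCopy k = (k , suc k) ∷ arrivals k

  -- A transversal takes every item that has arrived: the copies of the earlier
  -- items from their own parts, and the last item from part 0 if it has no copy yet.
  mutual
    transversal : ∀ k → Subset (len k)
    transversal zero    = inside ∷ []
    transversal (suc k) = inside ∷ transversalWithCopy k

    transversalWithCopy : ∀ k → Subset (suc (len k))
    transversalWithCopy zero    = inside ∷ outside ∷ []
    transversalWithCopy (suc k) = inside ∷ outside ∷ transversalWithCopy k

  selected-withCopy : ∀ k →
    select game (withCopy k) (transversalWithCopy k) ≡ map (λ j → j , suc j) (downFrom (suc k))
  selected-withCopy zero    = refl
  selected-withCopy (suc k) = cong ((suc k , suc (suc k)) ∷_) (selected-withCopy k)

  items<          : ∀ k → VecAll.All (λ e → proj₁ e ℕ.< suc k) (arrivals k)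
  items<-withCopy : ∀ k → VecAll.All (λ e → proj₁ e ℕ.< suc k) (withCopy k)
  items< zero    = s≤s z≤n ∷ []
  items< (suc k) = ℕ.n<1+n (suc k) ∷ VecAll.map ℕ.m<n⇒m<1+n (items<-withCopy k)
  items<-withCopy k = ℕ.n<1+n k ∷ items< k

  parts< : ∀ k → VecAll.All (λ e → proj₂ e ℕ.< suc k) (arrivals k)
  parts< zero    = s≤s z≤n ∷ []
  parts< (suc k) = s≤s z≤n ∷ ℕ.n<1+n (suc k) ∷ VecAll.map ℕ.m<n⇒m<1+n (parts< k)

  unique          : ∀ k → Unique (arrivals k)
  unique-withCopy : ∀ k → Unique (withCopy k)
  unique zero    = [] ∷ []
  unique (suc k) = VecAll.map (λ i< eq → ℕ.<⇒≢ i< (sym (cong proj₁ eq))) (items<-withCopy k) ∷ unique-withCopy k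
  unique-withCopy k = VecAll.map (λ i< eq → ℕ.<⇒≢ i< (sym (cong proj₂ eq))) (parts< k) ∷ unique k

  select-all : ∀ {P : ℕ × ℕ → Set} {n} {es : Vec (ℕ × ℕ) n} T →
    VecAll.All P es → All P (select game es T)
  select-all []            []       = []
  select-all (inside  ∷ T) (p ∷ ps) = p ∷ select-all T ps
  select-all (outside ∷ T) (p ∷ ps) = select-all T ps

  -- An independent set that contains every item is optimal, since no set counts
  -- an item twice.
  optimal : ∀ {n} (es : Vec (ℕ × ℕ) n) O m → VecAll.All (λ e → proj₁ e ℕ.< m) es →
    List.Unique (map proj₂ (select game es O)) → downFrom m ⊆ map proj₁ (select game es O) →
    IsOPT game es O
  optimal es O m es<m uniq covers = unique⇒independent game (select game es O) uniq , λ T _ →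
    ≤⇒≤ℝ {value game es T} {value game es O} (seq-f (select game es T)) (seq-f (select game es O))
      (ℚ.≤-trans (worth-≤ (select game es T) (downFrom m) (λ x∈ →
          let _ , e∈ , x≡ = ∈-map⁻ proj₁ x∈
          in ∈-downFrom⁺ (subst (ℕ._< m) (sym x≡) (All.lookup (select-all T es<m) e∈))))
        (worth-≥ (select game es O) (downFrom m) (downFrom⁺ m) covers))

  -- Part 0 is included in the list so that (k + 1 , 0) may be added to the set.
  distinct-parts : ∀ k → List.Unique (0 ∷ map proj₂ (select game (withCopy k) (transversalWithCopy k)))
  distinct-parts k = subst (λ ps → List.Unique (0 ∷ ps))
    (trans (map-∘ (downFrom (suc k))) (cong (map proj₂) (sym (selected-withCopy k))))
    (All.map⁺ (All.universal (λ _ ()) (downFrom (suc k))) ∷ map⁺ ℕ.suc-injective (downFrom⁺ (suc k)))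

  all-items : ∀ k → downFrom (suc k) ⊆ map proj₁ (select game (withCopy k) (transversalWithCopy k))
  all-items k {x} = subst (x ∈_) (trans (trans (sym (map-id (downFrom (suc k)))) (map-∘ (downFrom (suc k))))
    (cong (map proj₁) (sym (selected-withCopy k))))

  -- Playing against a strictly monotone algorithm

  module Play (A : Algorithm) (mono : StrictlyMonotone A) (r : ℝ) (comp : HasCompetitiveRatio A r)
    (c : ℚ) (0<c : 0ℚ ℚ.< c) (c≤r : ∃[ N ] (∀ n → N ℕ.≤ n → c ℚ.≤ seq r n)) where

    competitive : ∀ {n} (es : Vec (ℕ × ℕ) n) O m → Unique es → VecAll.All (λ e → proj₁ e ℕ.< m) es →
      List.Unique (map proj₂ (select game es O)) → downFrom m ⊆ map proj₁ (select game es O) →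
      c ℚ.* total (downFrom m) ℚ.≤ worth (held A game es)
    competitive es O m uniq es<m distinct covers =
      ≤ℝ⇒≤ {r *ℝ value game es O} {value game es (solution A game es)}
        (proj₁ c≤r , λ n N≤n → *-mono-≤ (0≤total (downFrom m)) (ℚ.≤-trans (ℚ.<⇒≤ 0<c) (proj₂ c≤r n N≤n))
          (proj₂ c≤r n N≤n)
          (ℚ.≤-trans (worth-≥ (select game es O) (downFrom m) (downFrom⁺ m) covers)
            (ℚ.≤-reflexive (sym (seq-f (select game es O) n)))))
        (seq-f (held A game es)) (comp game es uniq O (optimal es O m es<m distinct covers))

    competitive-arrivals : ∀ k → c ℚ.* total (downFrom (suc k)) ℚ.≤ worth (held A game (arrivals k))
    competitive-arrivals zero    = competitive (arrivals 0) (transversal 0) 1 (unique 0) (items< 0)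
      ([] ∷ []) (λ { (here refl) → here refl })
    competitive-arrivals (suc k) = competitive (arrivals (suc k)) (transversal (suc k)) (2 ℕ.+ k)
      (unique (suc k)) (items< (suc k)) (distinct-parts k)
      (λ { (here refl) → here refl ; (there x∈) → there (all-items k x∈) })

    competitive-withCopy : ∀ k → c ℚ.* total (downFrom (suc k)) ℚ.≤ worth (held A game (withCopy k))
    competitive-withCopy k = competitive (withCopy k) (transversalWithCopy k) (suc k)
      (unique-withCopy k) (items<-withCopy k) (AllPairs.tail (distinct-parts k)) (all-items k)

    improves : ∀ {n} e (es : Vec (ℕ × ℕ) n) → Unique (e ∷ es) →
      Vec.head (solution A game (e ∷ es)) ≡ inside →
      worth (held A game es) ℚ.< worth (held A game (e ∷ es))
    improves e es uniq taken =
      <ℝ⇒< {value game es (solution A game es)} {value game (e ∷ es) (solution A game (e ∷ es))}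
        (seq-f (held A game es)) (seq-f (held A game (e ∷ es))) (mono game e es uniq taken)

    -- Holding nothing has value 0, which a positive ratio forbids.
    not-empty : ∀ k {S} → S ≡ [] → ¬ (c ℚ.* total (downFrom (suc k)) ℚ.≤ worth S)
    not-empty k refl c*total≤0 = ℚ.<-irrefl refl
      (ℚ.<-≤-trans (*-pos 0<c (ℚ.+-mono-<-≤ (0<w k) (0≤total (downFrom k)))) c*total≤0)

    Holds : ℕ → ∀ {n} → Vec (ℕ × ℕ) n → Set
    Holds k es = held A game es ≡ [ (k , 0) ]

    -- If the copy were taken, the new set would consist of copies of item k, so its
    -- value would not exceed the old value w k.  If (k , 0) were dropped, nothing
    -- would be left, against the positive ratio.
    keeps : ∀ k → Holds k (arrivals k) → Holds k (withCopy k)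
    keeps k holds with round A game (k , suc k) (arrivals k)
    ... | K , K⊆held , cases with sublist-of-singleton (subst (Sublist K) holds K⊆held) | cases
    ... | inj₁ K≡ | inj₂ held≡ = ⊥-elim (not-empty k (trans held≡ K≡) (competitive-withCopy k))
    ... | inj₂ K≡ | inj₂ held≡ = trans held≡ K≡
    ... | copies  | inj₁ (taken , held≡) = ⊥-elim (ℚ.<-irrefl refl (begin-strict
      w k                               ≡⟨ worth-single k 0 ⟨
      worth [ (k , 0) ]                 ≡⟨ cong worth holds ⟨
      worth (held A game (arrivals k))  <⟨ improves (k , suc k) (arrivals k) (unique-withCopy k) taken ⟩
      worth (held A game (withCopy k))  ≡⟨ cong worth held≡ ⟩
      worth ((k , suc k) ∷ K)           ≤⟨ worth-copies k ((k , suc k) ∷ K) (refl ∷ copies-of copies) ⟩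
      w k                               ∎))
      where open ℚ.≤-Reasoning

    module Forced (forcing : ∀ k → w k ℚ.< c ℚ.* total (downFrom (2 ℕ.+ k))) where

      -- Rejection leaves at most w k, which is too little compared with the optimum
      -- of all items through k + 1.  After acceptance, (k , 0) cannot stay, because it
      -- lies in the same part.
      replaces : ∀ k → Holds k (withCopy k) →
        Vec.head (solution A game (arrivals (suc k))) ≡ inside × Holds (suc k) (arrivals (suc k))
      replaces k holds with round A game (suc k , 0) (withCopy k)
      ... | K , K⊆held , cases with sublist-of-singleton (subst (Sublist K) holds K⊆held) | cases
      ... | inj₁ refl | inj₁ (taken , held≡) = taken , held≡
      ... | inj₂ refl | inj₁ (taken , held≡) with
              subst (Independent game) held≡ (feasible A game (arrivals (suc k)) (unique (suc k))) 0
      ... | s≤s ()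
      replaces k holds | K , K⊆held , cases | copies | inj₂ held≡ = ⊥-elim (ℚ.<-irrefl refl (begin-strict
        w k                                     <⟨ forcing k ⟩
        c ℚ.* total (downFrom (2 ℕ.+ k))        ≤⟨ competitive-arrivals (suc k) ⟩
        worth (held A game (arrivals (suc k)))  ≡⟨ cong worth held≡ ⟩
        worth K                                 ≤⟨ worth-copies k K (copies-of copies) ⟩
        w k                                     ∎))
        where open ℚ.≤-Reasoning

      always-holds : ∀ k → Holds k (arrivals k)
      always-holds zero with round A game (0 , 0) []
      ... | _ , [] , inj₁ (_ , held≡) = held≡
      ... | _ , [] , inj₂ held≡       = ⊥-elim (not-empty 0 held≡ (competitive-arrivals 0))
      always-holds (suc k) = proj₂ (replaces k (keeps k (always-holds k)))

      rising : ∀ k → w k ℚ.< w (suc k)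
      rising k = begin-strict
        w k                                     ≡⟨ worth-single k 0 ⟨
        worth [ (k , 0) ]                       ≡⟨ cong worth (keeps k (always-holds k)) ⟨
        worth (held A game (withCopy k))        <⟨ improves (suc k , 0) (withCopy k) (unique (suc k)) taken ⟩
        worth (held A game (arrivals (suc k)))  ≡⟨ cong worth (always-holds (suc k)) ⟩
        worth [ (suc k , 0) ]                   ≡⟨ worth-single (suc k) 0 ⟩
        w (suc k)                               ∎
        where
        open ℚ.≤-Reasoning
        taken = proj₁ (replaces k (keeps k (always-holds k)))

-- From the real ratio to a rational one

theorem6p1 : ∀ (α : ℝ) (0<α : 0ℝ <ℝ α) → α <ℝ 4ℝ →
    ¬ (Σ[ A ∈ Algorithm ] Σ[ r ∈ ℝ ] (StrictlyMonotone A × recip α 0<α <ℝ r × HasCompetitiveRatio A r))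
theorem6p1 α (ε₀ , 0<ε₀ , N₀ , ε₀≤α) (ε , 0<ε , N₁ , α+ε≤4)
  (A , r , mono , (η , 0<η , N₂ , recip+η≤r) , comp) = not-always-rising rising
  where
  -- This makes q = 4 (1 − δ) equal to 4 − ε.
  δ : ℚ
  δ = half (half ε)

  open Growth δ (half-pos (half-pos 0<ε))
  open Game weights weights-pos

  q≡4-ε : q ≡ 4ℚ ℚ.- ε
  q≡4-ε = trans (expand δ) (cong (λ e → 4ℚ ℚ.- e)
    (trans (cong (λ h → h ℚ.+ h) (half+half (half ε))) (half+half ε)))
    where
    open +-*-Solver
    expand : ∀ δ → 4ℚ ℚ.* (1ℚ ℚ.- δ) ≡ 4ℚ ℚ.- ((δ ℚ.+ δ) ℚ.+ (δ ℚ.+ δ))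
    expand = solve 1 (λ δ → con 4ℚ :* (con 1ℚ :- δ) := con 4ℚ :- ((δ :+ δ) :+ (δ :+ δ))) refl

  ε₀≤ : ∀ n → N₀ ℕ.≤ n → ε₀ ℚ.≤ seq α n
  ε₀≤ n N₀≤n = subst (ℚ._≤ seq α n) (ℚ.+-identityˡ ε₀) (ε₀≤α n N₀≤n)

  ≤q : ∀ n → N₁ ℕ.≤ n → seq α n ℚ.≤ q
  ≤q n N₁≤n = begin
    seq α n                       ≡⟨ cancel (seq α n) ε ⟩
    seq α n ℚ.+ ε ℚ.- ε           ≤⟨ ℚ.+-monoˡ-≤ (ℚ.- ε) (α+ε≤4 n N₁≤n) ⟩
    4ℚ ℚ.- ε                      ≡⟨ q≡4-ε ⟨
    q                             ∎
    where
    open ℚ.≤-Reasoning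
    cancel : ∀ a b → a ≡ a ℚ.+ b ℚ.- b
    cancel = solve 2 (λ a b → a := a :+ b :- b) refl
      where open +-*-Solver

  ε₀≤q : ε₀ ℚ.≤ q
  ε₀≤q = ℚ.≤-trans (ε₀≤ (N₀ ℕ.⊔ N₁) (ℕ.m≤m⊔n N₀ N₁)) (≤q (N₀ ℕ.⊔ N₁) (ℕ.m≤n⊔m N₀ N₁))

  0<q : 0ℚ ℚ.< q
  0<q = ℚ.<-≤-trans 0<ε₀ ε₀≤q

  -- A rational strictly above 1 / q that is eventually below r.
  c : ℚ
  c = inv q 0<q ℚ.+ η

  0<c : 0ℚ ℚ.< c
  0<c = ℚ.+-mono-< (inv-pos q 0<q) 0<η

  -- Eventually α ≤ q, hence 1 / q ≤ 1 / α.  The maximum with ε₀ comes from the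
  -- definition of the reciprocal.
  c≤r : ∃[ N ] (∀ n → N ℕ.≤ n → c ℚ.≤ seq r n)
  c≤r = N₁ ℕ.⊔ N₂ , λ n N≤n → ℚ.≤-trans
    (ℚ.+-monoˡ-≤ η (inv-antitone (seq α n ⊔ ε₀) q (0<⊔ 0<ε₀ (seq α n)) 0<q
      (ℚ.⊔-lub (≤q n (ℕ.m⊔n≤o⇒m≤o N₁ N₂ N≤n)) ε₀≤q)))
    (recip+η≤r n (ℕ.m⊔n≤o⇒n≤o N₁ N₂ N≤n))

  1<cq : 1ℚ ℚ.< c ℚ.* q
  1<cq = begin-strict
    1ℚ                              ≡⟨ ℚ.+-identityʳ 1ℚ ⟨
    1ℚ ℚ.+ 0ℚ                       <⟨ ℚ.+-monoʳ-< 1ℚ (*-pos 0<η 0<q) ⟩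
    1ℚ ℚ.+ η ℚ.* q                  ≡⟨ cong (ℚ._+ η ℚ.* q) (inv-inverse q 0<q) ⟨
    inv q 0<q ℚ.* q ℚ.+ η ℚ.* q     ≡⟨ ℚ.*-distribʳ-+ q (inv q 0<q) η ⟨
    c ℚ.* q                         ∎
    where open ℚ.≤-Reasoning

  below≡total : ∀ k → below k ≡ total (downFrom k)
  below≡total zero    = refl
  below≡total (suc k) = cong (weights k ℚ.+_) (below≡total k)

  forcing : ∀ k → weights k ℚ.< c ℚ.* total (downFrom (2 ℕ.+ k))
  forcing k = begin-strict
    weights k                             ≡⟨ ℚ.*-identityˡ (weights k) ⟨
    1ℚ ℚ.* weights k                      <⟨ ℚ.*-monoˡ-<-pos (weights k) {{positive (weights-pos k)}} 1<cq ⟩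
    (c ℚ.* q) ℚ.* weights k               ≡⟨ ℚ.*-assoc c q (weights k) ⟩
    c ℚ.* (q ℚ.* weights k)               ≤⟨ ℚ.*-monoˡ-≤-nonNeg c {{nonNegative (ℚ.<⇒≤ 0<c)}} (below-large k) ⟩
    c ℚ.* below (2 ℕ.+ k)                 ≡⟨ cong (c ℚ.*_) (below≡total (2 ℕ.+ k)) ⟩
    c ℚ.* total (downFrom (2 ℕ.+ k))      ∎
    where open ℚ.≤-Reasoning

  open Play A mono r comp c 0<c c≤r
  open Forced forcing
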